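{- Let $r$ be a positive integer and let $P$ be an $r$-differential poset with rank sizes $p_n=|P_n|$ and rank gaps $\Delta p_n = p_n - p_{n-1}$. For $n \ge 0$ let $\tau_n$ be the number of thread elements in $P_n$. Then for all integers $n \ge 0$ and $N \geq 4n$, $$\Delta p_N \geq \tau_n.$$
   Context: Let $P$ be an $\mathbb{N}$-graded poset with $n$-th rank $P_n$ ($n \ge 0$), and let $\lessdot$ denote its covering relation. Let $\mathbb{Q}P_n$ be the $\mathbb{Q}$-vector space with basis $P_n$ (with $P_{ -1}=\emptyset$, so $p_{ -1}=0$). The up and down operators $U_n : \mathbb{Q}P_n \to \mathbb{Q}P_{n+1}$ and $D_n : \mathbb{Q}P_n \to \mathbb{Q}P_{n-1}$ are the linear maps given for $x \in P_n$ by $U_n x = \sum_{y : x \lessdot y} y$ and $D_n x = \sum_{z : z \lessdot x} z$. For a positive integer $r$, an $r$-differential poset is a locally finite $\mathbb{N}$-graded poset $P$ with unique minimal element $\hat{0}$ (so $P_0=\{\hat 0\}$) such that the operators above are well defined (each element is covered by finitely many elements, so that all ranks are finite) and $D_{n+1}U_n - U_{n-1}D_n = r\cdot I$ on $\mathbb{Q}P_n$ for all $n \geq 0$. An element $x \in P$ is a singleton if $x = \hat{0}$ or $x$ covers exactly one element of $P$. A thread element is a singleton $x \in P$ which covers another singleton (in particular $\hat 0$, which covers nothing, is not a thread element, so $\tau_0=0$). -}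

module Defs where

open import Level using (_⊔_) renaming (suc to lsuc)
open import Data.Nat.Base as ℕ using (ℕ; zero; suc; NonZero)
import Data.Nat.Properties as ℕ
open import Data.Integer.Base as ℤ using (ℤ; +_)
open import Data.Rational.Base as ℚ using (ℚ; 0ℚ; 1ℚ; _/_)
import Data.Rational.Properties as ℚ
open import Data.Bool.Base using (if_then_else_)
open import Data.Fin.Base using (Fin)
open import Data.Vec.Functional using (Vector)
open import Data.List.Base
  using (List; []; _∷_; length; lookup; filter; concatMap; deduplicate)
open import Data.List.Relation.Unary.All using ([]; _∷_)
open import Data.List.Relation.Unary.Any as Any using (Any; here; there)
open import Data.List.Relation.Unary.AllPairs using ([]; _∷_)
import Data.List.Membership.Setoid as Membership
import Data.List.Membership.Setoid.Properties as Mem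
import Data.List.Relation.Unary.Unique.Setoid as UniqueSetoid
import Data.List.Relation.Unary.Unique.Setoid.Properties as Uniq
import Data.List.Relation.Unary.Unique.DecSetoid.Properties as DecUniq
open import Data.Product using (∃; ∃!; _×_; _,_; proj₁; proj₂)
open import Data.Sum.Base using (_⊎_; inj₁; inj₂)
open import Relation.Binary.Bundles using (Setoid; DecSetoid; Poset)
open import Relation.Binary.Core using (Rel)
open import Relation.Binary.Definitions using (_Respects_)
import Relation.Binary.Definitions as B using (Decidable)
open import Relation.Binary.PropositionalEquality.Core as ≡ using (_≡_)
import Relation.Binary.Properties.Poset as PosetProperties
open import Relation.Nullary using (¬_; Dec; yes; no; does; contradiction)
open import Relation.Nullary.Decidable
  using (map′; _×-dec_; _⊎-dec_; ¬?)
open import Relation.Unary using (Pred; Decidable; _∩_)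

open import Algebra.Properties.Monoid.Sum ℚ.+-0-monoid using (sum-syntax)

-- A finite subset: a list of its members without repetition (up to ≈),
-- so that its cardinality is the length of the list.
record FiniteSubset {c ℓ q} (S : Setoid c ℓ) (Q : Pred (Setoid.Carrier S) q)
       : Set (c ⊔ ℓ ⊔ q) where
  open Setoid S using (Carrier)
  open Membership S using (_∈_)
  open UniqueSetoid S using (Unique)
  field
    elements : List Carrier
    unique   : Unique elements
    sound    : ∀ {x} → x ∈ elements → Q x
    complete : ∀ {x} → Q x → x ∈ elements

  card : ℕ
  card = length elements

open FiniteSubset

module _ {c ℓ} (S : Setoid c ℓ) where
  open Setoid S

  restrict : ∀ {q r} {Q : Pred Carrier q} {R : Pred Carrier r} →
             Decidable R → R Respects _≈_ →
             FiniteSubset S Q → FiniteSubset S (Q ∩ R)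
  restrict R? resp F = record
    { elements = filter R? (elements F)
    ; unique   = Uniq.filter⁺ S R? (unique F)
    ; sound    = λ x∈ → let x∈F , Rx = Mem.∈-filter⁻ S R? resp x∈
                        in sound F x∈F , Rx
    ; complete = λ (Qx , Rx) → Mem.∈-filter⁺ S R? resp (complete F Qx) Rx
    }

  exists? : ∀ {q r} {Q : Pred Carrier q} {R : Pred Carrier r} →
            Decidable R → R Respects _≈_ →
            FiniteSubset S Q → Dec (∃ λ x → Q x × R x)
  exists? R? resp F = map′
    (λ any → let x , x∈ , Rx = Membership.find S any in x , sound F x∈ , Rx)
    (λ (x , Qx , Rx) → Membership.lose S resp (complete F Qx) Rx)
    (Any.any? R? (elements F))

  ∃!? : ∀ {q} {Q : Pred Carrier q} → FiniteSubset S Q → Dec (∃! _≈_ Q)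
  ∃!? record { elements = [] ; complete = comp } =
    no λ (_ , Qx , _) → contradiction (comp Qx) λ ()
  ∃!? record { elements = x ∷ [] ; sound = snd ; complete = comp } =
    yes (x , snd (here refl) , λ Qy → only (comp Qy))
    where
    only : ∀ {y} → Any (y ≈_) (x ∷ []) → x ≈ y
    only (here y≈x) = sym y≈x
  ∃!? record { elements = x ∷ y ∷ _ ; unique = (x≉y ∷ _) ∷ _ ; sound = snd } =
    no λ (_ , _ , z!) →
      x≉y (trans (sym (z! (snd (here refl)))) (z! (snd (there (here refl)))))

module Covering {c ℓ₁ ℓ₂} (P : Poset c ℓ₁ ℓ₂) where
  open Poset P
  open PosetProperties P using (_<_)

  infix 4 _⋖_
  _⋖_ : Rel Carrier (c ⊔ ℓ₁ ⊔ ℓ₂)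
  x ⋖ y = x < y × (∀ {z} → ¬ (x < z × z < y))

  IsMinimal : Pred Carrier (c ⊔ ℓ₁ ⊔ ℓ₂)
  IsMinimal x = ∀ {y} → y ≤ x → y ≈ x

-- Together the fields say that every maximal chain has the form
-- x₀ ⋖ x₁ ⋖ x₂ ⋖ ⋯ with xᵢ of rank i.
record IsℕGraded {c ℓ₁ ℓ₂} (P : Poset c ℓ₁ ℓ₂)
                 (rank : Poset.Carrier P → ℕ) : Set (c ⊔ ℓ₁ ⊔ ℓ₂) where
  open Poset P
  open PosetProperties P using (_<_)
  open Covering P
  field
    rank-cong   : ∀ {x y} → x ≈ y → rank x ≡ rank y
    rank-mono-< : ∀ {x y} → x < y → rank x ℕ.< rank y
    rank-⋖      : ∀ {x y} → x ⋖ y → rank y ≡ suc (rank x)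
    ⋖-below     : ∀ {x n} → rank x ≡ suc n → ∃ λ z → z ⋖ x

-- The posets on whose ranks the up and down operators make sense.
record GradedPoset c ℓ₁ ℓ₂ : Set (lsuc (c ⊔ ℓ₁ ⊔ ℓ₂)) where
  field
    poset : Poset c ℓ₁ ℓ₂
  open Poset poset public
  open PosetProperties poset public using (_<_; <-respˡ-≈; <-respʳ-≈)
  open Covering poset public

  S : Setoid c ℓ₁
  S = record { isEquivalence = isEquivalence }

  field
    rank          : Carrier → ℕ
    isℕGraded     : IsℕGraded poset rank
    locallyFinite : ∀ x y → FiniteSubset S (λ z → x ≤ z × z ≤ y)
    0̂             : Carrier
    0̂-minimal     : IsMinimal 0̂
    0̂-unique      : ∀ {x} → IsMinimal x → x ≈ 0̂
    finiteCovers  : ∀ x → FiniteSubset S (λ y → x ⋖ y)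
  open IsℕGraded isℕGraded public

  -- x ≤ y holds exactly when the interval [x , y] is inhabited.
  _≤?_ : B.Decidable _≤_
  x ≤? y with elements (locallyFinite x y) | sound (locallyFinite x y)
            | complete (locallyFinite x y)
  ... | []    | _   | comp =
    no λ x≤y → contradiction (comp (refl , x≤y)) λ ()
  ... | z ∷ _ | snd | _    =
    let x≤z , z≤y = snd (here Eq.refl) in yes (trans x≤z z≤y)

  _≟_ : B.Decidable _≈_
  x ≟ y = map′ (λ (p , q) → antisym p q)
               (λ e → reflexive e , reflexive (Eq.sym e))
               (x ≤? y ×-dec y ≤? x)

  _<?_ : B.Decidable _<_
  x <? y = (x ≤? y) ×-dec ¬? (x ≟ y)

  _⋖?_ : B.Decidable _⋖_
  x ⋖? y = (x <? y) ×-dec map′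
    (λ ∄ {z} (x<z , z<y) →
      ∄ (z , (proj₁ x<z , proj₁ z<y) , (x<z , z<y)))
    (λ none (z , _ , between) → none between)
    (¬? (exists? S (λ z → x <? z ×-dec z <? y)
          (λ e (p , q) → <-respʳ-≈ e p , <-respˡ-≈ e q)
          (locallyFinite x y)))

  ⋖-respˡ : ∀ {y} → (_⋖ y) Respects _≈_
  ⋖-respˡ e (x<y , none) =
    <-respˡ-≈ e x<y , λ (p , q) → none (<-respˡ-≈ (Eq.sym e) p , q)

  ⋖-respʳ : ∀ {x} → (x ⋖_) Respects _≈_
  ⋖-respʳ e (x<y , none) =
    <-respʳ-≈ e x<y , λ (p , q) → none (p , <-respʳ-≈ (Eq.sym e) q)

  rank-0̂ : rank 0̂ ≡ 0
  rank-0̂ with rank 0̂ in eq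
  ... | zero  = ≡.refl
  ... | suc _ = let _ , ((z≤0̂ , z≉0̂) , _) = ⋖-below eq
                in contradiction (0̂-minimal z≤0̂) z≉0̂

  rank0⇒≈0̂ : ∀ {x} → rank x ≡ 0 → x ≈ 0̂
  rank0⇒≈0̂ {x} eq = 0̂-unique minimal
    where
    minimal : IsMinimal x
    minimal {y} y≤x with y ≟ x
    ... | yes y≈x = y≈x
    ... | no  y≉x = contradiction
      (≡.subst (rank y ℕ.<_) eq (rank-mono-< (y≤x , y≉x))) λ ()

  private
    decSetoid : DecSetoid c ℓ₁
    decSetoid = record
      { isDecEquivalence = record
          { isEquivalence = isEquivalence ; _≟_ = _≟_ } }

  open Membership S using (_∈_)

  finiteRank : ∀ n → FiniteSubset S (λ x → rank x ≡ n)
  finiteRank zero = record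
    { elements = 0̂ ∷ []
    ; unique   = [] ∷ []
    ; sound    = λ { (here e) → ≡.trans (rank-cong e) rank-0̂ }
    ; complete = λ eq → here (rank0⇒≈0̂ eq)
    }
  finiteRank (suc n) = record
    { elements = deduplicate _≟_ ups
    ; unique   = DecUniq.deduplicate-! decSetoid ups
    ; sound    = λ y∈ → sound′ (Mem.∈-deduplicate⁻ S _≟_ ups y∈)
    ; complete = λ eq → Mem.∈-deduplicate⁺ S _≟_
                          (λ e p → Eq.trans p (Eq.sym e)) (complete′ eq)
    }
    where
    covers : Carrier → List Carrier
    covers x = elements (finiteCovers x)

    ups : List Carrier
    ups = concatMap covers (elements (finiteRank n))

    sound′ : ∀ {y} → y ∈ ups → rank y ≡ suc n
    sound′ y∈ =
      let _ , x∈ , y∈x = Membership.find S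
                           (Mem.∈-concatMap⁻ S S {f = covers} y∈)
      in ≡.trans (rank-⋖ (sound (finiteCovers _) y∈x))
                 (≡.cong suc (sound (finiteRank n) x∈))

    complete′ : ∀ {y} → rank y ≡ suc n → y ∈ ups
    complete′ eq =
      let x , x⋖y = ⋖-below eq
          rx      = ℕ.suc-injective (≡.trans (≡.sym (rank-⋖ x⋖y)) eq)
      in Mem.∈-concatMap⁺ S S {f = covers}
           (Any.map (λ x≈x′ → complete (finiteCovers _) (⋖-respˡ x≈x′ x⋖y))
                    (complete (finiteRank n) rx))

  lowerCovers : ∀ x → FiniteSubset S (_⋖ x)
  lowerCovers x = record
    { elements = elements F
    ; unique   = unique F
    ; sound    = λ z∈ → proj₂ (sound F z∈)
    ; complete = λ z⋖x → complete F
                   (≡.sym (≡.cong ℕ.pred (rank-⋖ z⋖x)) , z⋖x)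
    }
    where F = restrict S (_⋖? x) ⋖-respˡ (finiteRank (ℕ.pred (rank x)))

  IsSingleton : Pred Carrier (c ⊔ ℓ₁ ⊔ ℓ₂)
  IsSingleton x = x ≈ 0̂ ⊎ ∃! _≈_ (_⋖ x)

  IsThread : Pred Carrier (c ⊔ ℓ₁ ⊔ ℓ₂)
  IsThread x = IsSingleton x × (∃ λ y → y ⋖ x × IsSingleton y)

  IsSingleton-resp : IsSingleton Respects _≈_
  IsSingleton-resp e (inj₁ x≈0̂) = inj₁ (Eq.trans (Eq.sym e) x≈0̂)
  IsSingleton-resp e (inj₂ (z , z⋖x , z!)) =
    inj₂ (z , ⋖-respʳ e z⋖x , λ w⋖y → z! (⋖-respʳ (Eq.sym e) w⋖y))

  IsThread-resp : IsThread Respects _≈_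
  IsThread-resp e (sing , z , z⋖x , singz) =
    IsSingleton-resp e sing , z , ⋖-respʳ e z⋖x , singz

  isSingleton? : Decidable IsSingleton
  isSingleton? x = (x ≟ 0̂) ⊎-dec ∃!? S (lowerCovers x)

  isThread? : Decidable IsThread
  isThread? x = isSingleton? x ×-dec
    exists? S isSingleton? IsSingleton-resp (lowerCovers x)

  threads : ∀ n → FiniteSubset S ((λ x → rank x ≡ n) ∩ IsThread)
  threads n = restrict S isThread? IsThread-resp (finiteRank n)

  τ : ℕ → ℕ
  τ n = card (threads n)

  -- P⁻ n is the rank of index n - 1, empty for n = 0; similarly p⁻ and U⁻.
  P P⁻ : ℕ → List Carrier
  P n = elements (finiteRank n)
  P⁻ zero    = []
  P⁻ (suc n) = P n

  p p⁻ : ℕ → ℕ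
  p  n = length (P n)
  p⁻ n = length (P⁻ n)

  Δp : ℕ → ℤ
  Δp n = + p n ℤ.- + p⁻ n

  -- The vector space with basis xs, in coordinates.
  ℚ⟨_⟩ : List Carrier → Set
  ℚ⟨ xs ⟩ = Vector ℚ (length xs)

  -- The linear map sending the i-th basis vector to f i.
  linear : ∀ {m n} → (Fin m → Vector ℚ n) → Vector ℚ m → Vector ℚ n
  linear {m} f v j = ∑[ i < m ] (v i ℚ.* f i j)

  -- The sum of those basis vectors that satisfy Q.
  basisSum : ∀ {q} {Q : Pred Carrier q} → Decidable Q → ∀ ys → ℚ⟨ ys ⟩
  basisSum Q? ys j = if does (Q? (lookup ys j)) then 1ℚ else 0ℚ

  U⁻ : ∀ n → ℚ⟨ P⁻ n ⟩ → ℚ⟨ P n ⟩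
  U⁻ n = linear λ i → basisSum (λ y → lookup (P⁻ n) i ⋖? y) (P n)

  U : ∀ n → ℚ⟨ P n ⟩ → ℚ⟨ P (suc n) ⟩
  U n = U⁻ (suc n)

  D : ∀ n → ℚ⟨ P n ⟩ → ℚ⟨ P⁻ n ⟩
  D n = linear λ i → basisSum (λ z → z ⋖? lookup (P n) i) (P⁻ n)

record DifferentialPoset (r : ℕ) c ℓ₁ ℓ₂ : Set (lsuc (c ⊔ ℓ₁ ⊔ ℓ₂)) where
  field
    gradedPoset : GradedPoset c ℓ₁ ℓ₂
  open GradedPoset gradedPoset public
  field
    commutation : ∀ n (v : ℚ⟨ P n ⟩) i →
      D (suc n) (U n v) i ℚ.- U⁻ n (D n v) i ≡ (+ r / 1) ℚ.* v i

{-# OPTIONS --safe #-}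
module Submission where

-- A thread element x covering w has r + 1 upper covers, and since
-- DU x = r x + U w these have r + up(w) ≤ 2r + 1 lower covers in total; so one
-- of them covers x only. Hence the τₙ threads continue injectively to every
-- higher rank, and D maps the thread basis vectors of rank N to those of rank
-- N − 1, and these to those of rank N − 2, as long as N ≥ n + 2.
--
-- Let U v = a with a in the span of the threads of rank N. Then
-- |a|² = |U v|² = r |v|² + |D v|², while |a| ≤ |v| because the coordinates of a
-- are the coordinates of v at the threads of rank N − 1. Therefore D v = 0, so
-- r v = D U v = D a, so D (D a) = 0, and a = 0 as D D is injective on threads;
-- then v = 0. Thus U is injective and its image is independent of the threads,
-- which gives p_{N−1} + τₙ ≤ p_N.

open import Defs

open import Algebra.Bundles using (CommutativeRing)
open import Algebra.Core using (Op₁; Op₂)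
open import Algebra.Structures using (IsCommutativeRing)
open import Data.Bool.Base using (Bool; true; false; if_then_else_)
import Data.Bool.Properties as Bool
open import Data.Fin.Base using (Fin; zero; suc; punchIn; punchOut; splitAt; _↑ˡ_; _↑ʳ_)
open import Data.Fin.Properties
  using (_≟_; punchInᵢ≢i; punchIn-punchOut; punchOut-injective; suc-injective; all?; any?; ¬∀⟶∃¬; join-splitAt)
import Data.Integer.Properties as ℤ
open import Data.List.Base using ([]; _∷_; lookup)
open import Data.List.Membership.Propositional.Properties using (∈-lookup)
import Data.List.Membership.Setoid.Properties as Mem
import Data.List.Relation.Unary.All as All
open import Data.List.Relation.Unary.AllPairs using (_∷_)
open import Data.List.Relation.Unary.Any as Any using (here)
open import Data.List.Relation.Unary.Any.Properties using (lookup-index)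
open import Data.List.Relation.Unary.Unique.Setoid using (Unique)
open import Data.Nat.Base as ℕ using (ℕ; zero; suc; NonZero)
import Data.Nat.Properties as ℕ
open import Data.Product using (∃-syntax; Σ-syntax; _×_; _,_; proj₁; proj₂)
open import Data.Rational.Base as ℚ using (0ℚ; 1ℚ)
import Data.Rational.Properties as ℚ
import Data.Rational.Unnormalised.Base as ℚᵘ
import Data.Rational.Unnormalised.Properties as ℚᵘ
open import Data.Sum.Base using (inj₁; inj₂)
open import Data.Vec.Functional using (Vector; _++_; insertAt)
open import Data.Vec.Functional.Properties using (insertAt-lookup; insertAt-punchIn; lookup-++ˡ; lookup-++ʳ)
open import Function.Base using (_∘_; flip; const)
open import Function.Bundles using (mk⇔)
open import Function.Definitions using (Injective)
open import Level using (0ℓ)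
open import Relation.Binary.Bundles using (Setoid; Poset)
open import Relation.Binary.Core using (Rel)
open import Relation.Binary.Definitions using (DecidableEquality)
open import Relation.Binary.PropositionalEquality
  using (_≡_; _≢_; _≗_; refl; sym; trans; cong; cong₂; subst; subst₂; module ≡-Reasoning)
import Relation.Binary.Reasoning.PartialOrder as PosetReasoning
open import Relation.Binary.Structures using (IsTotalOrder)
open import Relation.Nullary using (¬_; Dec; yes; no; does; contradiction)
open import Relation.Nullary.Decidable using (dec-true; dec-false; does-⇔)

-- Covering relations as Boolean matrices.

private variable
  k l m n : ℕ

-- The covering relation between two consecutive ranks, the lower rank indexing rows. Boolean
-- entries match the `does` tests in the coordinates of `U` and `D`.
Adjacency : ℕ → ℕ → Set
Adjacency m n = Fin m → Fin n → Bool

-- An equality of Booleans rather than a unique existence: under `ι` it says that column `y` is the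
-- basis vector `δ x`, which is how `D` acts on a thread.
CoversOnly : Adjacency m n → Fin n → Fin m → Set
CoversOnly R y x = ∀ z → R z y ≡ does (x ≟ z)

-- The property shared by both kinds of singleton, the minimal element having no lower cover at all.
CoversAtMostOne : Adjacency m n → Fin n → Set
CoversAtMostOne R y = ∀ z z′ → R z y ≡ true → R z′ y ≡ true → z ≡ z′

does≡true⇒ : ∀ {a} {A : Set a} (a? : Dec A) → does a? ≡ true → A
does≡true⇒ (yes a) _ = a

CoversOnly-self : (R : Adjacency m n) {y : Fin n} {x : Fin m} → CoversOnly R y x → R x y ≡ true
CoversOnly-self R {x = x} only = trans (only x) (dec-true (x ≟ x) refl)

CoversOnly⇒≡ : (R : Adjacency m n) {y : Fin n} {x z : Fin m} → CoversOnly R y x → R z y ≡ true → x ≡ z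
CoversOnly⇒≡ R {x = x} {z} only Rzy = does≡true⇒ (x ≟ z) (trans (sym (only z)) Rzy)

CoversOnly⇒CoversAtMostOne : (R : Adjacency m n) {y : Fin n} {x : Fin m} →
                             CoversOnly R y x → CoversAtMostOne R y
CoversOnly⇒CoversAtMostOne R {x = x} only z z′ Rzy Rz′y =
  trans (sym (CoversOnly⇒≡ R {x = x} only Rzy)) (CoversOnly⇒≡ R {x = x} only Rz′y)

-- An element has only one lower cover here, so `t i ≡ t j` forces `t′ i ≡ t′ j`. Distinctness thus
-- passes upwards along threads.
CoversOnly-injective : (R : Adjacency m n) {t : Fin k → Fin n} {t′ : Fin k → Fin m} →
  (∀ i → CoversOnly R (t i) (t′ i)) → Injective _≡_ _≡_ t′ → Injective _≡_ _≡_ t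
CoversOnly-injective R {t} {t′} only inj {i} {j} ti≡tj = inj
  (CoversOnly⇒≡ R (only i) (trans (cong (R (t′ j)) ti≡tj) (CoversOnly-self R (only j))))

-- Linear algebra over an ordered domain

-- No inverses are available: elimination cross-multiplies, and nonzero factors are cancelled by
-- `x*y≡0⇒y≡0`.
record OrderedDomain : Set₁ where
  infixl 7 _*_
  infixl 6 _+_
  infix  8 -_
  infix  4 _≤_ _≟ᴷ_
  field
    Carrier : Set
    _+_ _*_ : Op₂ Carrier
    -_      : Op₁ Carrier
    0# 1#   : Carrier
    _≤_     : Rel Carrier 0ℓ
    isCommutativeRing : IsCommutativeRing _≡_ _+_ _*_ -_ 0# 1#
    isTotalOrder      : IsTotalOrder _≡_ _≤_
    _≟ᴷ_              : DecidableEquality Carrier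
    0≢1               : 0# ≢ 1#
    x*y≡0⇒y≡0         : ∀ {x y} → x ≢ 0# → x * y ≡ 0# → y ≡ 0#
    +-mono-≤          : ∀ {x y z w} → x ≤ y → z ≤ w → x + z ≤ y + w
    *-nonneg          : ∀ {x y} → 0# ≤ x → 0# ≤ y → 0# ≤ x * y

module LinearAlgebra (F : OrderedDomain) where
  open OrderedDomain F renaming (Carrier to K)

  private
    commutativeRing : CommutativeRing 0ℓ 0ℓ
    commutativeRing = record { isCommutativeRing = isCommutativeRing }

  open CommutativeRing commutativeRing
    using (_-_; +-comm; +-identityˡ; +-identityʳ; +-assoc; *-identityˡ; *-identityʳ; *-assoc; *-comm;
           *-commutativeSemigroup; distribˡ; zeroˡ; zeroʳ; -‿inverseˡ; -‿inverseʳ; ring; semiring)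
  open IsTotalOrder isTotalOrder using (isPartialOrder; total; antisym)
    renaming (refl to ≤-refl; reflexive to ≤-reflexive; trans to ≤-trans)
  open import Algebra.Properties.Semiring.Sum semiring
  open import Algebra.Properties.Ring ring
    using (-‿distribˡ-*; -‿distribʳ-*; -‿+-comm; -0#≈0#; x∙y⁻¹≈ε⇒x≈y; [y-z]x≈yx-zx; -‿involutive)
  open import Algebra.Properties.CommutativeSemigroup *-commutativeSemigroup
    using () renaming (x∙yz≈y∙xz to *-x∙yz≈y∙xz)

  private
    poset : Poset 0ℓ 0ℓ 0ℓ
    poset = record { isPartialOrder = isPartialOrder }

    module ≤-Reasoning = PosetReasoning poset

  -- Inequalities and finite sums.

  -‿nonneg : ∀ {x} → x ≤ 0# → 0# ≤ - x
  -‿nonneg {x} x≤0 = subst₂ _≤_ (-‿inverseʳ x) (+-identityˡ (- x)) (+-mono-≤ x≤0 ≤-refl)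

  square-nonneg : ∀ x → 0# ≤ x * x
  square-nonneg x with total 0# x
  ... | inj₁ 0≤x = *-nonneg 0≤x 0≤x
  ... | inj₂ x≤0 = subst (0# ≤_) neg-square (*-nonneg (-‿nonneg x≤0) (-‿nonneg x≤0))
    where
    neg-square : - x * - x ≡ x * x
    neg-square = trans (sym (-‿distribˡ-* x (- x)))
      (trans (cong -_ (sym (-‿distribʳ-* x x))) (-‿involutive (x * x)))

  0≤1 : 0# ≤ 1#
  0≤1 = subst (0# ≤_) (*-identityˡ 1#) (square-nonneg 1#)

  1≰0 : ¬ 1# ≤ 0#
  1≰0 1≤0 = 0≢1 (antisym 0≤1 1≤0)

  +-cancelʳ-≤ : ∀ z {x y} → x + z ≤ y + z → x ≤ y
  +-cancelʳ-≤ z {x} {y} x+z≤y+z = subst₂ _≤_ (cancel x z) (cancel y z) (+-mono-≤ x+z≤y+z (≤-refl { - z}))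
    where
    cancel : ∀ x z → (x + z) + - z ≡ x
    cancel x z = trans (+-assoc x z (- z)) (trans (cong (x +_) (-‿inverseʳ z)) (+-identityʳ x))

  sum-neg : (f : Vector K n) → sum (λ i → - f i) ≡ - sum f
  sum-neg {zero}  f = sym -0#≈0#
  sum-neg {suc n} f = trans (cong (- f zero +_) (sum-neg (f ∘ suc))) (-‿+-comm (f zero) (sum (f ∘ suc)))

  sum-minus : (f g : Vector K n) → sum (λ i → f i - g i) ≡ sum f - sum g
  sum-minus f g = trans (∑-distrib-+ f (λ i → - g i)) (cong (sum f +_) (sum-neg g))

  sum-zero : {f : Vector K n} → (∀ i → f i ≡ 0#) → sum f ≡ 0#
  sum-zero {n} f≗0 = trans (sum-cong-≗ f≗0) (sum-replicate-zero n)

  sum-nonneg : {f : Vector K n} → (∀ i → 0# ≤ f i) → 0# ≤ sum f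
  sum-nonneg {zero}  0≤f = ≤-refl
  sum-nonneg {suc n} {f} 0≤f = subst (_≤ sum f) (+-identityˡ 0#)
    (+-mono-≤ (0≤f zero) (sum-nonneg (0≤f ∘ suc)))

  sum-mono-≤ : {f g : Vector K n} → (∀ i → f i ≤ g i) → sum f ≤ sum g
  sum-mono-≤ {zero}  f≤g = ≤-refl
  sum-mono-≤ {suc n} f≤g = +-mono-≤ (f≤g zero) (sum-mono-≤ (f≤g ∘ suc))

  sum-single : (f : Vector K n) (j : Fin n) → (∀ i → i ≢ j → f i ≡ 0#) → sum f ≡ f j
  sum-single {suc n} f j f≡0 = begin
    sum f                        ≡⟨ sum-remove f ⟩
    f j + sum (f ∘ punchIn j)    ≡⟨ cong (f j +_) (sum-zero λ i → f≡0 _ (punchInᵢ≢i j i)) ⟩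
    f j + 0#                     ≡⟨ +-identityʳ _ ⟩
    f j                          ∎
    where open ≡-Reasoning

  -- Induction on `k`: the term at `t zero` is split off the full sum, and the remaining values of
  -- `t` are renumbered by `punchOut` so as to avoid it.
  sum-∘-injective-≤ : {f : Vector K n} (t : Fin k → Fin n) → Injective _≡_ _≡_ t →
                      (∀ j → 0# ≤ f j) → sum (f ∘ t) ≤ sum f
  sum-∘-injective-≤ {k = zero} t inj 0≤f = sum-nonneg 0≤f
  sum-∘-injective-≤ {n = zero} {k = suc k} t inj 0≤f with () ← t zero
  sum-∘-injective-≤ {n = suc n} {k = suc k} {f} t inj 0≤f = begin
    f t₀ + sum (f ∘ t ∘ suc)          ≡⟨ cong (f t₀ +_) (sum-cong-≗ λ i → cong f (punchIn-punchOut (t₀≢ i))) ⟨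
    f t₀ + sum (f ∘ punchIn t₀ ∘ t′)  ≤⟨ +-mono-≤ ≤-refl (sum-∘-injective-≤ t′ inj′ (0≤f ∘ punchIn t₀)) ⟩
    f t₀ + sum (f ∘ punchIn t₀)       ≡⟨ sum-remove f ⟨
    sum f                             ∎
    where
    open ≤-Reasoning
    t₀ = t zero
    t₀≢ : ∀ i → t₀ ≢ t (suc i)
    t₀≢ i eq with () ← inj eq
    t′ : Fin k → Fin n
    t′ i = punchOut (t₀≢ i)
    inj′ : Injective _≡_ _≡_ t′
    inj′ {i} {j} eq = suc-injective (inj (punchOut-injective (t₀≢ i) (t₀≢ j) eq))

  term≤sum : {f : Vector K n} → (∀ i → 0# ≤ f i) → ∀ i → f i ≤ sum f
  term≤sum {f = f} 0≤f i = subst (_≤ sum f) (+-identityʳ (f i))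
    (sum-∘-injective-≤ {k = 1} (const i) (λ { {zero} {zero} _ → refl }) 0≤f)

  sum-↑ : (f : Vector K (m ℕ.+ n)) → sum f ≡ sum (f ∘ (_↑ˡ n)) + sum (f ∘ (m ↑ʳ_))
  sum-↑ {zero}  f = sym (+-identityˡ _)
  sum-↑ {suc m} {n} f =
    trans (cong (f zero +_) (sum-↑ {m} {n} (f ∘ suc)))
      (sym (+-assoc (f zero) (sum (λ i → f (suc (i ↑ˡ n)))) (sum (λ i → f (suc (m ↑ʳ i))))))

  -- Kernels of wide matrices by elimination.

  Matrix : ℕ → ℕ → Set
  Matrix m n = Fin m → Fin n → K

  -- Column p is cleared from the rows below the first by cross-multiplication with the pivot.
  module Elimination (A : Matrix (suc n) (suc m)) (p : Fin (suc m)) where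
    private
      a : K
      a = A zero p
      rest : Matrix (suc n) m
      rest j i = A j (punchIn p i)

    eliminate : Matrix n m
    eliminate j i = a * rest (suc j) i - A (suc j) p * rest zero i

    module _ (w : Vector K m) where
      private
        dot : Fin (suc n) → K
        dot j = sum (λ i → rest j i * w i)

      -- Scaling `w` by the pivot `a` lets the entry at `p` be chosen as `- dot zero` without
      -- division, so that the first row is annihilated.
      extend : Vector K (suc m)
      extend = insertAt (λ i → a * w i) p (- dot zero)

      extend-p : extend p ≡ - dot zero
      extend-p = insertAt-lookup (λ i → a * w i) p (- dot zero)

      extend-punchIn : ∀ i → extend (punchIn p i) ≡ a * w i
      extend-punchIn = insertAt-punchIn (λ i → a * w i) p (- dot zero)

      private
        expand : ∀ j → sum (λ i → A j i * extend i) ≡ a * dot j - A j p * dot zero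
        expand j = begin
          sum (λ i → A j i * extend i)
            ≡⟨ sum-remove {i = p} (λ i → A j i * extend i) ⟩
          A j p * extend p + sum (λ i → rest j i * extend (punchIn p i))
            ≡⟨ cong₂ _+_ (cong (A j p *_) extend-p)
                 (sum-cong-≗ λ i → trans (cong (rest j i *_) (extend-punchIn i)) (*-x∙yz≈y∙xz (rest j i) a (w i))) ⟩
          A j p * - dot zero + sum (λ i → a * (rest j i * w i))
            ≡⟨ cong (A j p * - dot zero +_) (*-distribˡ-sum a (λ i → rest j i * w i)) ⟨
          A j p * - dot zero + a * dot j
            ≡⟨ trans (cong (_+ a * dot j) (sym (-‿distribʳ-* (A j p) (dot zero))))
                (+-comm (- (A j p * dot zero)) (a * dot j)) ⟩
          a * dot j - A j p * dot zero ∎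
          where open ≡-Reasoning

      extend-zero : sum (λ i → A zero i * extend i) ≡ 0#
      extend-zero = trans (expand zero) (-‿inverseʳ (a * dot zero))

      extend-suc : ∀ j → sum (λ i → A (suc j) i * extend i) ≡ sum (λ i → eliminate j i * w i)
      extend-suc j = begin
        sum (λ i → A (suc j) i * extend i)
          ≡⟨ expand (suc j) ⟩
        a * dot (suc j) - A (suc j) p * dot zero
          ≡⟨ cong₂ _-_ (*-distribˡ-sum a (λ i → rest (suc j) i * w i))
                       (*-distribˡ-sum (A (suc j) p) (λ i → rest zero i * w i)) ⟩
        sum (λ i → a * (rest (suc j) i * w i)) - sum (λ i → A (suc j) p * (rest zero i * w i))
          ≡⟨ sum-minus (λ i → a * (rest (suc j) i * w i)) (λ i → A (suc j) p * (rest zero i * w i)) ⟨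
        sum (λ i → a * (rest (suc j) i * w i) - A (suc j) p * (rest zero i * w i))
          ≡⟨ sum-cong-≗ (λ i →
                trans (cong₂ _-_ (sym (*-assoc a (rest (suc j) i) (w i)))
                                 (sym (*-assoc (A (suc j) p) (rest zero i) (w i))))
                      (sym ([y-z]x≈yx-zx (w i) (a * rest (suc j) i) (A (suc j) p * rest zero i)))) ⟩
        sum (λ i → eliminate j i * w i) ∎
        where open ≡-Reasoning

  -- Induction on the number of rows. A zero first row imposes no condition; otherwise a nonzero
  -- entry serves as pivot, and the extended vector stays nonzero because its entries away from `p`
  -- are `a * w i` with `a` nonzero.
  wide⇒kernel : (A : Matrix n m) → n ℕ.< m →
                Σ[ v ∈ Vector K m ] (¬ (∀ i → v i ≡ 0#)) × (∀ j → sum (λ i → A j i * v i) ≡ 0#)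
  wide⇒kernel {zero} {suc m} A _ = const 1# , (λ v≗0 → contradiction (sym (v≗0 zero)) 0≢1) , λ ()
  wide⇒kernel {suc n} {suc m} A (ℕ.s≤s n<m) with all? (λ i → A zero i ≟ᴷ 0#)
  ... | yes A₀≗0 =
    let v , v≢0 , Av≡0 = wide⇒kernel (A ∘ suc) (ℕ.m<n⇒m<1+n n<m)
    in v , v≢0 , λ
      { zero    → sum-zero λ i → trans (cong (_* v i) (A₀≗0 i)) (zeroˡ (v i))
      ; (suc j) → Av≡0 j }
  ... | no ¬A₀≗0 =
    let p , a≢0 = ¬∀⟶∃¬ _ _ (λ i → A zero i ≟ᴷ 0#) ¬A₀≗0
        open Elimination A p
        w , w≢0 , A′w≡0 = wide⇒kernel eliminate n<m
    in extend w
     , (λ v≗0 → w≢0 λ i → x*y≡0⇒y≡0 a≢0 (trans (sym (extend-punchIn w i)) (v≗0 (punchIn p i))))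
     , λ { zero → extend-zero w ; (suc j) → trans (extend-suc w j) (A′w≡0 j) }

  -- Row vectors acting on matrices, and the standard inner product.

  infix 8 _ᵀ
  _ᵀ : Matrix m n → Matrix n m
  A ᵀ = flip A

  infixl 7 _▷_
  -- Row `i` of the matrix is the image of the `i`-th basis vector, as in `linear`; `U` is then
  -- `_▷ ⟦ A ⟧` and `D` is `_▷ ⟦ A ⟧ ᵀ`.
  _▷_ : Vector K m → Matrix m n → Vector K n
  (v ▷ A) j = sum (λ i → v i * A i j)

  ▷-congˡ : ∀ {v w : Vector K m} (A : Matrix m n) → v ≗ w → v ▷ A ≗ w ▷ A
  ▷-congˡ A v≗w j = sum-cong-≗ λ i → cong (_* A i j) (v≗w i)

  ▷-zeroˡ : ∀ {v : Vector K m} (A : Matrix m n) → (∀ i → v i ≡ 0#) → ∀ j → (v ▷ A) j ≡ 0#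
  ▷-zeroˡ A v≗0 j = sum-zero λ i → trans (cong (_* A i j) (v≗0 i)) (zeroˡ (A i j))

  ▷-*ˡ : ∀ c (v : Vector K m) (A : Matrix m n) j → ((λ i → c * v i) ▷ A) j ≡ c * (v ▷ A) j
  ▷-*ˡ c v A j = trans (sum-cong-≗ λ i → *-assoc c (v i) (A i j))
    (sym (*-distribˡ-sum c (λ i → v i * A i j)))

  ▷-assoc : (v : Vector K l) (A : Matrix l m) (B : Matrix m n) → v ▷ A ▷ B ≗ v ▷ (λ i → A i ▷ B)
  ▷-assoc v A B k = begin
    sum (λ j → sum (λ i → v i * A i j) * B j k)
      ≡⟨ sum-cong-≗ (λ j → *-distribʳ-sum (B j k) (λ i → v i * A i j)) ⟩
    sum (λ j → sum (λ i → v i * A i j * B j k))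
      ≡⟨ ∑-comm (λ j i → v i * A i j * B j k) ⟩
    sum (λ i → sum (λ j → v i * A i j * B j k))
      ≡⟨ sum-cong-≗ (λ i → trans (sum-cong-≗ λ j → *-assoc (v i) (A i j) (B j k))
                                 (sym (*-distribˡ-sum (v i) (λ j → A i j * B j k)))) ⟩
    sum (λ i → v i * sum (λ j → A i j * B j k)) ∎
    where open ≡-Reasoning

  infix 7 _∙_
  _∙_ : Vector K n → Vector K n → K
  v ∙ w = sum (λ i → v i * w i)

  ∙-congˡ : {u v : Vector K n} (w : Vector K n) → u ≗ v → u ∙ w ≡ v ∙ w
  ∙-congˡ w u≗v = sum-cong-≗ λ i → cong (_* w i) (u≗v i)

  ∙-congʳ : (u : Vector K n) {v w : Vector K n} → v ≗ w → u ∙ v ≡ u ∙ w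
  ∙-congʳ u v≗w = sum-cong-≗ λ i → cong (u i *_) (v≗w i)

  ∙-comm : (v w : Vector K n) → v ∙ w ≡ w ∙ v
  ∙-comm v w = sum-cong-≗ λ i → *-comm (v i) (w i)

  ▷-adjoint : (v : Vector K m) (A : Matrix m n) (w : Vector K n) → (v ▷ A) ∙ w ≡ v ∙ (w ▷ A ᵀ)
  -- Associativity applies once `w` is read as a matrix with a single column.
  ▷-adjoint v A w = trans (▷-assoc {n = 1} v A (λ j _ → w j) zero)
    (∙-congʳ v λ i → ∙-comm (A i) w)

  ∙-nonneg : (v : Vector K n) → 0# ≤ v ∙ v
  ∙-nonneg v = sum-nonneg λ i → square-nonneg (v i)

  ∙-definite : {v : Vector K n} → v ∙ v ≤ 0# → ∀ i → v i ≡ 0#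
  ∙-definite {v = v} vv≤0 i with v i ≟ᴷ 0#
  ... | yes eq = eq
  ... | no  ne = x*y≡0⇒y≡0 ne (antisym
    (≤-trans (term≤sum (λ j → square-nonneg (v j)) i) vv≤0)
    (square-nonneg (v i)))

  -- 0/1 matrices and basis vectors.

  ι : Bool → K
  ι b = if b then 1# else 0#

  ι-square : ∀ b → ι b * ι b ≡ ι b
  ι-square true  = *-identityˡ 1#
  ι-square false = zeroˡ 0#

  ι-nonneg : ∀ b → 0# ≤ ι b
  ι-nonneg true  = 0≤1
  ι-nonneg false = ≤-refl

  ⟦_⟧ : Adjacency m n → Matrix m n
  ⟦ R ⟧ i j = ι (R i j)

  δ : Fin n → Vector K n
  δ i j = ι (does (i ≟ j))

  δ-refl : (i : Fin n) → δ i i ≡ 1#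
  δ-refl i = cong ι (dec-true (i ≟ i) refl)

  δ-≢ : {i j : Fin n} → i ≢ j → δ i j ≡ 0#
  δ-≢ {i = i} {j} i≢j = cong ι (dec-false (i ≟ j) i≢j)

  ∙-δ : (v : Vector K n) (j : Fin n) → v ∙ δ j ≡ v j
  ∙-δ v j = begin
    v ∙ δ j      ≡⟨ sum-single (λ i → v i * δ j i) j (λ i i≢j → trans (cong (v i *_) (δ-≢ (i≢j ∘ sym))) (zeroʳ (v i))) ⟩
    v j * δ j j  ≡⟨ cong (v j *_) (δ-refl j) ⟩
    v j * 1#     ≡⟨ *-identityʳ (v j) ⟩
    v j          ∎
    where open ≡-Reasoning

  δ-▷ : (i : Fin m) (A : Matrix m n) → δ i ▷ A ≗ A i
  δ-▷ i A j = trans (∙-comm (δ i) (λ z → A z j)) (∙-δ (λ z → A z j) i)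

  -- The vector `a ▷ (δ ∘ t)` places the coefficient `a i` at position `t i`; injectivity of `t`
  -- keeps coefficients from adding up.
  ▷-δ∘ : (a : Vector K k) (t : Fin k → Fin n) → Injective _≡_ _≡_ t →
         ∀ i → (a ▷ (δ ∘ t)) (t i) ≡ a i
  ▷-δ∘ a t inj i = begin
    (a ▷ (δ ∘ t)) (t i)   ≡⟨ sum-single (λ j → a j * δ (t j) (t i)) i (λ j j≢i → trans (cong (a j *_) (δ-≢ (j≢i ∘ inj))) (zeroʳ (a j))) ⟩
    a i * δ (t i) (t i)   ≡⟨ cong (a i *_) (δ-refl (t i)) ⟩
    a i * 1#              ≡⟨ *-identityʳ (a i) ⟩
    a i                   ∎
    where open ≡-Reasoning

  δ∘-▷ : (a : Vector K k) (t : Fin k → Fin m) (A : Matrix m n) →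
         a ▷ (δ ∘ t) ▷ A ≗ a ▷ (A ∘ t)
  δ∘-▷ a t A z = trans (▷-assoc a (δ ∘ t) A z) (sum-cong-≗ λ i → cong (a i *_) (δ-▷ (t i) A z))

  -- The hypothesis is linear independence of the rows of `A` and `B` together. If there were more
  -- than `n` of them, the matrix `C`, whose columns are the rows of `A` and the negated rows of
  -- `B`, would have a nonzero kernel vector, and its two blocks `v` and `a` would satisfy the
  -- relation.
  independent⇒≤ : (A : Matrix m n) (B : Matrix k n) →
    (∀ v a → v ▷ A ≗ a ▷ B → (∀ i → v i ≡ 0#) × (∀ i → a i ≡ 0#)) →
    m ℕ.+ k ℕ.≤ n
  independent⇒≤ {m} {n} {k} A B indep with m ℕ.+ k ℕ.≤? n
  ... | yes m+k≤n = m+k≤n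
  ... | no  m+k≰n = contradiction zeros (proj₁ (proj₂ ker))
    where
    C : Matrix n (m ℕ.+ k)
    C j = (λ i → A i j) ++ (λ i → - B i j)
    ker = wide⇒kernel C (ℕ.≰⇒> m+k≰n)
    w = proj₁ ker
    v : Vector K m
    v i = w (i ↑ˡ k)
    a : Vector K k
    a i = w (m ↑ʳ i)
    open ≡-Reasoning
    eq : v ▷ A ≗ a ▷ B
    eq j = x∙y⁻¹≈ε⇒x≈y ((v ▷ A) j) ((a ▷ B) j) (begin
      (v ▷ A) j - (a ▷ B) j
        ≡⟨ cong ((v ▷ A) j +_) (sum-neg (λ i → a i * B i j)) ⟨
      (v ▷ A) j + sum (λ i → - (a i * B i j))
        ≡⟨ cong₂ _+_
             (sum-cong-≗ λ i → trans (*-comm (v i) (A i j))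
                (cong (_* v i) (sym (lookup-++ˡ (λ i → A i j) (λ i → - B i j) i))))
             (sum-cong-≗ λ i → trans (-‿distribʳ-* (a i) (B i j)) (trans (*-comm (a i) (- B i j))
                (cong (_* a i) (sym (lookup-++ʳ (λ i → A i j) (λ i → - B i j) i))))) ⟩
      sum (λ i → C j (i ↑ˡ k) * w (i ↑ˡ k)) + sum (λ i → C j (m ↑ʳ i) * w (m ↑ʳ i))
        ≡⟨ sum-↑ {m} {k} (λ i → C j i * w i) ⟨
      sum (λ i → C j i * w i)
        ≡⟨ proj₂ (proj₂ ker) j ⟩
      0# ∎)
    zeros : ∀ i → w i ≡ 0#
    zeros i with splitAt m i | join-splitAt m k i
    ... | inj₁ i′ | refl = proj₁ (indep v a eq) i′
    ... | inj₂ i′ | refl = proj₂ (indep v a eq) i′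

  -- Up and down operators

  Commutes : K → Adjacency l m → Adjacency m n → Set
  Commutes {m = m} r B A = (v : Vector K m) (i : Fin m) →
    (v ▷ ⟦ A ⟧ ▷ ⟦ A ⟧ ᵀ) i ≡ r * v i + (v ▷ ⟦ B ⟧ ᵀ ▷ ⟦ B ⟧) i

  -- The rank gap forced by threads through three consecutive ranks.

  module _ {r : K} (1≤r : 1# ≤ r) where

    private
      ≤-r* : ∀ {x} → 0# ≤ x → x ≤ r * x
      ≤-r* {x} 0≤x = subst₂ _≤_ (+-identityˡ x) eq (+-mono-≤ (*-nonneg 0≤r-1 0≤x) ≤-refl)
        where
        0≤r-1 : 0# ≤ r - 1#
        0≤r-1 = subst (_≤ r - 1#) (-‿inverseʳ 1#) (+-mono-≤ 1≤r ≤-refl)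
        open ≡-Reasoning
        eq : (r - 1#) * x + x ≡ r * x
        eq = begin
          (r - 1#) * x + x        ≡⟨ cong (_+ x) ([y-z]x≈yx-zx x r 1#) ⟩
          r * x - 1# * x + x      ≡⟨ cong (λ y → r * x - y + x) (*-identityˡ x) ⟩
          r * x - x + x           ≡⟨ +-assoc (r * x) (- x) x ⟩
          r * x + (- x + x)       ≡⟨ cong (r * x +_) (-‿inverseˡ x) ⟩
          r * x + 0#              ≡⟨ +-identityʳ (r * x) ⟩
          r * x                   ∎

      r≢0 : r ≢ 0#
      r≢0 r≡0 = 1≰0 (subst (1# ≤_) r≡0 1≤r)

    -- The threads occupy positions `t`, `t′`, `t″` in three consecutive ranks, from top to bottom.
    -- Both steps down are used, since `a` is recovered after applying `D` twice.
    module _ (B : Adjacency l m) (A : Adjacency m n) (commutes : Commutes r B A)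
             {t : Fin k → Fin n} {t′ : Fin k → Fin m} {t″ : Fin k → Fin l}
             (t-only : ∀ i → CoversOnly A (t i) (t′ i))
             (t′-only : ∀ i → CoversOnly B (t′ i) (t″ i))
             (t″-injective : Injective _≡_ _≡_ t″)
      where
      private
        t′-injective = CoversOnly-injective B t′-only t″-injective
        t-injective  = CoversOnly-injective A t-only t′-injective

      private module _ (v : Vector K m) (a : Vector K k) (Uv≗a : v ▷ ⟦ A ⟧ ≗ a ▷ (δ ∘ t)) where
        open ≤-Reasoning

        Dv : Vector K _
        Dv = v ▷ ⟦ B ⟧ ᵀ

        v∘t′≗a : ∀ i → v (t′ i) ≡ a i
        v∘t′≗a i = begin-equality
          v (t′ i)               ≡⟨ ∙-δ v (t′ i) ⟨
          v ∙ δ (t′ i)           ≡⟨ ∙-congʳ v (λ z → cong ι (t-only i z)) ⟨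
          (v ▷ ⟦ A ⟧) (t i)      ≡⟨ Uv≗a (t i) ⟩
          (a ▷ (δ ∘ t)) (t i)    ≡⟨ ▷-δ∘ a t t-injective i ⟩
          a i                    ∎

        -- Since `U` and `D` are transposes, pairing the commutation relation with `v` turns `D U v`
        -- into the squared norm of `U v` and `U D v` into that of `D v`.
        norm-identity : r * (v ∙ v) + Dv ∙ Dv ≡ a ∙ a
        norm-identity = begin-equality
          r * (v ∙ v) + Dv ∙ Dv
            ≡⟨ cong₂ _+_ (*-distribˡ-sum r (λ i → v i * v i)) (▷-adjoint v (⟦ B ⟧ ᵀ) Dv) ⟩
          sum (λ i → r * (v i * v i)) + v ∙ (Dv ▷ ⟦ B ⟧)
            ≡⟨ ∑-distrib-+ (λ i → r * (v i * v i)) (λ i → v i * (Dv ▷ ⟦ B ⟧) i) ⟨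
          sum (λ i → r * (v i * v i) + v i * (Dv ▷ ⟦ B ⟧) i)
            ≡⟨ sum-cong-≗ (λ i → trans (cong (_+ v i * (Dv ▷ ⟦ B ⟧) i) (*-x∙yz≈y∙xz r (v i) (v i)))
                                       (sym (distribˡ (v i) (r * v i) ((Dv ▷ ⟦ B ⟧) i)))) ⟩
          v ∙ (λ i → r * v i + (Dv ▷ ⟦ B ⟧) i)
            ≡⟨ ∙-congʳ v (commutes v) ⟨
          v ∙ (v ▷ ⟦ A ⟧ ▷ ⟦ A ⟧ ᵀ)
            ≡⟨ ▷-adjoint v ⟦ A ⟧ (v ▷ ⟦ A ⟧) ⟨
          (v ▷ ⟦ A ⟧) ∙ (v ▷ ⟦ A ⟧)
            ≡⟨ ∙-congˡ (v ▷ ⟦ A ⟧) Uv≗a ⟩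
          (a ▷ (δ ∘ t)) ∙ (v ▷ ⟦ A ⟧)
            ≡⟨ ▷-adjoint a (δ ∘ t) (v ▷ ⟦ A ⟧) ⟩
          a ∙ (v ▷ ⟦ A ⟧ ▷ (δ ∘ t) ᵀ)
            ≡⟨ ∙-congʳ a (λ i → trans (∙-δ (v ▷ ⟦ A ⟧) (t i)) (trans (Uv≗a (t i)) (▷-δ∘ a t t-injective i))) ⟩
          a ∙ a ∎

        a∙a≤v∙v : a ∙ a ≤ v ∙ v
        a∙a≤v∙v = subst (_≤ v ∙ v) (sum-cong-≗ λ i → cong₂ _*_ (v∘t′≗a i) (v∘t′≗a i))
          (sum-∘-injective-≤ {f = λ j → v j * v j} t′ t′-injective (λ j → square-nonneg (v j)))

        v∙v+Dv∙Dv≤a∙a : v ∙ v + Dv ∙ Dv ≤ a ∙ a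
        v∙v+Dv∙Dv≤a∙a = subst (v ∙ v + Dv ∙ Dv ≤_) norm-identity (+-mono-≤ (≤-r* (∙-nonneg v)) ≤-refl)

        Dv≗0 : ∀ i → Dv i ≡ 0#
        -- The two bounds enclose `a ∙ a`; cancelling `v ∙ v` leaves `Dv ∙ Dv ≤ 0#`.
        Dv≗0 = ∙-definite (+-cancelʳ-≤ (v ∙ v) (begin
          Dv ∙ Dv + v ∙ v   ≡⟨ +-comm (Dv ∙ Dv) (v ∙ v) ⟩
          v ∙ v + Dv ∙ Dv   ≤⟨ v∙v+Dv∙Dv≤a∙a ⟩
          a ∙ a             ≤⟨ a∙a≤v∙v ⟩
          v ∙ v             ≡⟨ +-identityˡ (v ∙ v) ⟨
          0# + v ∙ v        ∎))

        -- Obtained by applying `D` to `U v = a`: the term `U D v` has vanished, and `D` carries the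
        -- thread vectors at `t` to those at `t′`.
        rv≗a : ∀ z → r * v z ≡ (a ▷ (δ ∘ t′)) z
        rv≗a z = begin-equality
          r * v z                              ≡⟨ +-identityʳ (r * v z) ⟨
          r * v z + 0#                         ≡⟨ cong (r * v z +_) (▷-zeroˡ ⟦ B ⟧ Dv≗0 z) ⟨
          r * v z + (Dv ▷ ⟦ B ⟧) z             ≡⟨ commutes v z ⟨
          (v ▷ ⟦ A ⟧ ▷ ⟦ A ⟧ ᵀ) z              ≡⟨ ▷-congˡ (⟦ A ⟧ ᵀ) Uv≗a z ⟩
          (a ▷ (δ ∘ t) ▷ ⟦ A ⟧ ᵀ) z            ≡⟨ δ∘-▷ a t (⟦ A ⟧ ᵀ) z ⟩
          (a ▷ (λ i z → ⟦ A ⟧ z (t i))) z      ≡⟨ sum-cong-≗ (λ i → cong (λ b → a i * ι b) (t-only i z)) ⟩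
          (a ▷ (δ ∘ t′)) z                     ∎

        -- A second application of `D` moves `a` from `t′` to `t″`, while on the other side it gives
        -- `r` times `D v`, which is zero.
        a≗0 : ∀ i → a i ≡ 0#
        a≗0 i = begin-equality
          a i                                            ≡⟨ ▷-δ∘ a t″ t″-injective i ⟨
          (a ▷ (δ ∘ t″)) (t″ i)                          ≡⟨ sum-cong-≗ (λ j → cong (λ b → a j * ι b) (t′-only j (t″ i))) ⟨
          (a ▷ (λ j z → ⟦ B ⟧ z (t′ j))) (t″ i)          ≡⟨ δ∘-▷ a t′ (⟦ B ⟧ ᵀ) (t″ i) ⟨
          (a ▷ (δ ∘ t′) ▷ ⟦ B ⟧ ᵀ) (t″ i)                ≡⟨ ▷-congˡ (⟦ B ⟧ ᵀ) rv≗a (t″ i) ⟨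
          ((λ z → r * v z) ▷ ⟦ B ⟧ ᵀ) (t″ i)             ≡⟨ ▷-*ˡ r v (⟦ B ⟧ ᵀ) (t″ i) ⟩
          r * Dv (t″ i)                                  ≡⟨ cong (r *_) (Dv≗0 (t″ i)) ⟩
          r * 0#                                         ≡⟨ zeroʳ r ⟩
          0#                                             ∎

        v≗0 : ∀ i → v i ≡ 0#
        v≗0 i = x*y≡0⇒y≡0 r≢0 (trans (rv≗a i) (▷-zeroˡ (δ ∘ t′) a≗0 i))

      threads⇒gap : m ℕ.+ k ℕ.≤ n
      threads⇒gap = independent⇒≤ ⟦ A ⟧ (δ ∘ t) λ v a Uv≗a → v≗0 v a Uv≗a , a≗0 v a Uv≗a

  -- Continuation of a thread to the next rank.

  down : Adjacency m n → Fin n → K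
  down R y = sum (λ z → ι (R z y))

  CoversAtMostOne⇒down≤1 : (R : Adjacency m n) {y : Fin n} → CoversAtMostOne R y → down R y ≤ 1#
  CoversAtMostOne⇒down≤1 R {y} amo with any? (λ z → R z y Bool.≟ true)
  ... | yes (z , Rzy) = ≤-reflexive (trans (sum-single (λ i → ι (R i y)) z λ i i≢z → others i i≢z) (cong ι Rzy))
    where
    others : ∀ i → i ≢ z → ι (R i y) ≡ 0#
    others i i≢z = cong ι (Bool.¬-not λ Riy → i≢z (amo i z Riy Rzy))
  ... | no none = subst (_≤ 1#) (sym (sum-zero λ i → cong ι (Bool.¬-not λ Riy → none (i , Riy)))) 0≤1

  -- Column `y` departs from `δ x` at some `z`. At `x` itself they agree, so `z` differs from `x`
  -- and must be a second lower cover.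
  ¬CoversOnly⇒2≤down : (R : Adjacency m n) {y : Fin n} {x : Fin m} → R x y ≡ true → ¬ CoversOnly R y x →
                       1# + 1# ≤ down R y
  ¬CoversOnly⇒2≤down {m} R {y} {x} Rxy ¬only = subst (_≤ down R y) eq
    (sum-∘-injective-≤ {f = λ z → ι (R z y)} pair pair-injective (λ z → ι-nonneg (R z y)))
    where
    other = ¬∀⟶∃¬ m _ (λ z → R z y Bool.≟ does (x ≟ z)) ¬only
    z = proj₁ other
    x≢z : x ≢ z
    x≢z x≡z = proj₂ other
      (trans (trans (cong (λ u → R u y) (sym x≡z)) Rxy) (sym (dec-true (x ≟ z) x≡z)))
    Rzy : R z y ≡ true
    Rzy = Bool.¬-not (λ Rzy≡false → proj₂ other (trans Rzy≡false (sym (dec-false (x ≟ z) x≢z))))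
    pair : Fin 2 → Fin m
    pair zero    = x
    pair (suc _) = z
    pair-injective : Injective _≡_ _≡_ pair
    pair-injective {zero}     {zero}     _   = refl
    pair-injective {zero}     {suc _}    x≡z = contradiction x≡z x≢z
    pair-injective {suc _}    {zero}     z≡x = contradiction (sym z≡x) x≢z
    pair-injective {suc zero} {suc zero} _   = refl
    eq : ι (R x y) + (ι (R z y) + 0#) ≡ 1# + 1#
    eq = cong₂ _+_ (cong ι Rxy) (trans (+-identityʳ (ι (R z y))) (cong ι Rzy))

  module _ {o} {r : K} (B : Adjacency l m) (A : Adjacency m n) (C : Adjacency n o)
           (commutesᵐ : Commutes r B A) (commutesⁿ : Commutes r A C)
           {w : Fin m} {x : Fin n} (w-single : CoversAtMostOne B w) (x-only : CoversOnly A x w)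
    where
    private
      open ≤-Reasoning

      D : δ x ▷ ⟦ A ⟧ ᵀ ≗ δ w
      D z = trans (δ-▷ x (⟦ A ⟧ ᵀ) z) (cong ι (x-only z))

      -- The left side counts common upper covers of `x` and `x′`, which is the coefficient of `x′`
      -- in `D U x`; on the right, `U D x` is `U w`.
      DU : ∀ x′ → sum (λ y → ι (C x y) * ι (C x′ y)) ≡ r * δ x x′ + ι (A w x′)
      DU x′ = begin-equality
        sum (λ y → ι (C x y) * ι (C x′ y))                       ≡⟨ ▷-congˡ (⟦ C ⟧ ᵀ) (δ-▷ x ⟦ C ⟧) x′ ⟨
        (δ x ▷ ⟦ C ⟧ ▷ ⟦ C ⟧ ᵀ) x′                               ≡⟨ commutesⁿ (δ x) x′ ⟩
        r * δ x x′ + (δ x ▷ ⟦ A ⟧ ᵀ ▷ ⟦ A ⟧) x′                  ≡⟨ cong (r * δ x x′ +_) (trans (▷-congˡ ⟦ A ⟧ D x′) (δ-▷ w ⟦ A ⟧ x′)) ⟩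
        r * δ x x′ + ι (A w x′)                                  ∎

      r*δ : ∀ {p} (i : Fin p) → r * δ i i ≡ r
      r*δ i = trans (cong (r *_) (δ-refl i)) (*-identityʳ r)

      up-x : sum (λ y → ι (C x y)) ≡ r + 1#
      up-x = begin-equality
        sum (λ y → ι (C x y))               ≡⟨ sum-cong-≗ (λ y → ι-square (C x y)) ⟨
        sum (λ y → ι (C x y) * ι (C x y))   ≡⟨ DU x ⟩
        r * δ x x + ι (A w x)               ≡⟨ cong₂ _+_ (r*δ x) (cong ι (CoversOnly-self A x-only)) ⟩
        r + 1#                              ∎

      -- The coefficient of `w` in `D U w` is its number of upper covers, and in `r w + U D w` it is
      -- `r` plus its number of lower covers.
      up-w : sum (λ x′ → ι (A w x′)) ≤ r + 1#
      up-w = begin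
        sum (λ x′ → ι (A w x′))                        ≡⟨ sum-cong-≗ (λ x′ → ι-square (A w x′)) ⟨
        sum (λ x′ → ι (A w x′) * ι (A w x′))           ≡⟨ ▷-congˡ (⟦ A ⟧ ᵀ) (δ-▷ w ⟦ A ⟧) w ⟨
        (δ w ▷ ⟦ A ⟧ ▷ ⟦ A ⟧ ᵀ) w                      ≡⟨ commutesᵐ (δ w) w ⟩
        r * δ w w + (δ w ▷ ⟦ B ⟧ ᵀ ▷ ⟦ B ⟧) w          ≡⟨ cong₂ _+_ (r*δ w) (▷-congˡ ⟦ B ⟧ (δ-▷ w (⟦ B ⟧ ᵀ)) w) ⟩
        r + sum (λ z → ι (B z w) * ι (B z w))          ≡⟨ cong (r +_) (sum-cong-≗ (λ z → ι-square (B z w))) ⟩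
        r + down B w                                   ≤⟨ +-mono-≤ ≤-refl (CoversAtMostOne⇒down≤1 B w-single) ⟩
        r + 1#                                         ∎

      -- Double counting of the pairs `(y , x′)` with `y` above both `x` and `x′`: for fixed `x′`
      -- their number is given by `DU`.
      total-down : sum (λ y → ι (C x y) * down C y) ≤ r + (r + 1#)
      total-down = begin
        sum (λ y → ι (C x y) * down C y)                        ≡⟨ sum-cong-≗ (λ y → *-distribˡ-sum (ι (C x y)) (λ x′ → ι (C x′ y))) ⟩
        sum (λ y → sum (λ x′ → ι (C x y) * ι (C x′ y)))         ≡⟨ ∑-comm (λ y x′ → ι (C x y) * ι (C x′ y)) ⟩
        sum (λ x′ → sum (λ y → ι (C x y) * ι (C x′ y)))         ≡⟨ sum-cong-≗ DU ⟩
        sum (λ x′ → r * δ x x′ + ι (A w x′))                    ≡⟨ ∑-distrib-+ (λ x′ → r * δ x x′) (λ x′ → ι (A w x′)) ⟩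
        sum (λ x′ → r * δ x x′) + sum (λ x′ → ι (A w x′))       ≡⟨ cong (_+ sum (λ x′ → ι (A w x′))) (∙-δ (λ _ → r) x) ⟩
        r + sum (λ x′ → ι (A w x′))                             ≤⟨ +-mono-≤ ≤-refl up-w ⟩
        r + (r + 1#)                                            ∎

    -- x has r + 1 upper covers, which have at most 2r + 1 lower covers in total.
    thread-extends : ∃[ y ] CoversOnly C y x
    thread-extends with any? (λ y → all? (λ z → C z y Bool.≟ does (x ≟ z)))
    ... | yes found = found
    ... | no  none  = contradiction (+-cancelʳ-≤ (r + (r + 1#)) bound) 1≰0
      where
      term : ∀ y → ι (C x y) + ι (C x y) ≤ ι (C x y) * down C y
      term y with C x y in Cxy
      ... | true  = subst (1# + 1# ≤_) (sym (*-identityˡ (down C y)))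
                      (¬CoversOnly⇒2≤down C Cxy λ only → none (y , only))
      ... | false = ≤-reflexive (trans (+-identityˡ 0#) (sym (zeroˡ (down C y))))

      -- If every upper cover of `x` had a second lower cover, the total would be at least
      -- `2(r + 1)`, against the bound `2r + 1`.
      bound : 1# + (r + (r + 1#)) ≤ 0# + (r + (r + 1#))
      bound = begin
        1# + (r + (r + 1#))                                   ≡⟨ +-assoc 1# r (r + 1#) ⟨
        1# + r + (r + 1#)                                     ≡⟨ cong (_+ (r + 1#)) (+-comm 1# r) ⟩
        r + 1# + (r + 1#)                                     ≡⟨ cong₂ _+_ up-x up-x ⟨
        sum (λ y → ι (C x y)) + sum (λ y → ι (C x y))         ≡⟨ ∑-distrib-+ (λ y → ι (C x y)) (λ y → ι (C x y)) ⟨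
        sum (λ y → ι (C x y) + ι (C x y))                     ≤⟨ sum-mono-≤ term ⟩
        sum (λ y → ι (C x y) * down C y)                      ≤⟨ total-down ⟩
        r + (r + 1#)                                          ≡⟨ +-identityˡ (r + (r + 1#)) ⟨
        0# + (r + (r + 1#))                                   ∎

-- Differential posets

open import Data.Nat.Base using (_*_; _≤_)
open import Data.Integer.Base as ℤ using (+_)

-- Auxiliary facts on rationals, lists and integers.

ℚ-orderedDomain : OrderedDomain
ℚ-orderedDomain = record
  { isCommutativeRing = ℚ.+-*-isCommutativeRing
  ; isTotalOrder      = ℚ.≤-isTotalOrder
  ; _≟ᴷ_              = ℚ._≟_
  ; 0≢1               = λ ()
  ; x*y≡0⇒y≡0         = cancel
  ; +-mono-≤          = ℚ.+-mono-≤
  ; *-nonneg          = λ {x} {y} 0≤x 0≤y → ℚ.nonNegative⁻¹ (x ℚ.* y)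
      {{ℚ.nonNeg*nonNeg⇒nonNeg x {{ℚ.nonNegative 0≤x}} y {{ℚ.nonNegative 0≤y}}}}
  }
  where
  cancel : ∀ {x y} → x ≢ 0ℚ → x ℚ.* y ≡ 0ℚ → y ≡ 0ℚ
  cancel {x} {y} x≢0 xy≡0 = begin
    y                    ≡⟨ ℚ.*-identityˡ y ⟨
    1ℚ ℚ.* y             ≡⟨ cong (ℚ._* y) (ℚ.*-inverseˡ x) ⟨
    ℚ.1/ x ℚ.* x ℚ.* y   ≡⟨ ℚ.*-assoc (ℚ.1/ x) x y ⟩
    ℚ.1/ x ℚ.* (x ℚ.* y) ≡⟨ cong (ℚ.1/ x ℚ.*_) xy≡0 ⟩
    ℚ.1/ x ℚ.* 0ℚ        ≡⟨ ℚ.*-zeroʳ (ℚ.1/ x) ⟩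
    0ℚ                   ∎
    where
    open ≡-Reasoning
    instance
      x≠0 : ℚ.NonZero x
      x≠0 = ℚ.≢-nonZero x≢0

1≤r/1 : ∀ r .{{_ : NonZero r}} → 1ℚ ℚ.≤ + r ℚ./ 1
1≤r/1 r@(suc _) = ℚ.toℚᵘ-cancel-≤ (ℚᵘ.≤-respʳ-≃ (ℚᵘ.≃-sym (ℚ.toℚᵘ-fromℚᵘ (ℚᵘ.mkℚᵘ (+ r) 0)))
  (ℚᵘ.*≤* (ℤ.*-monoʳ-≤-nonNeg (+ 1) {+ 1} {+ r} (ℤ.+≤+ (ℕ.s≤s ℕ.z≤n)))))

x-y≡z⇒x≡z+y : ∀ {x y z} → x ℚ.- y ≡ z → x ≡ z ℚ.+ y
x-y≡z⇒x≡z+y {x} {y} {z} eq = begin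
  x                      ≡⟨ ℚ.+-identityʳ x ⟨
  x ℚ.+ 0ℚ               ≡⟨ cong (x ℚ.+_) (ℚ.+-inverseˡ y) ⟨
  x ℚ.+ (ℚ.- y ℚ.+ y)    ≡⟨ ℚ.+-assoc x (ℚ.- y) y ⟨
  x ℚ.- y ℚ.+ y          ≡⟨ cong (ℚ._+ y) eq ⟩
  z ℚ.+ y                ∎
  where open ≡-Reasoning

Unique⇒lookup-injective : ∀ {c ℓ} (S : Setoid c ℓ) {xs} → Unique S xs → ∀ i j →
                          Setoid._≈_ S (lookup xs i) (lookup xs j) → i ≡ j
Unique⇒lookup-injective S (_ ∷ _)  zero    zero    _  = refl
Unique⇒lookup-injective S (x≉ ∷ _) zero    (suc j) eq = contradiction eq (All.lookup x≉ (∈-lookup j))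
Unique⇒lookup-injective S (x≉ ∷ _) (suc i) zero    eq = contradiction (Setoid.sym S eq) (All.lookup x≉ (∈-lookup i))
Unique⇒lookup-injective S (_ ∷ u)  (suc i) (suc j) eq = cong suc (Unique⇒lookup-injective S u i j eq)

m+k≤n⇒k≤n-m : ∀ {m k n} → m ℕ.+ k ≤ n → + k ℤ.≤ + n ℤ.- + m
m+k≤n⇒k≤n-m {m} {k} {n} m+k≤n = begin
  + k                            ≡⟨ ℤ.+-cancelˡ-⊖ m k 0 ⟨
  (m ℕ.+ k) ℤ.⊖ (m ℕ.+ 0)        ≡⟨ cong ((m ℕ.+ k) ℤ.⊖_) (ℕ.+-identityʳ m) ⟩
  (m ℕ.+ k) ℤ.⊖ m                ≤⟨ ℤ.⊖-monoˡ-≤ m m+k≤n ⟩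
  n ℤ.⊖ m                        ≡⟨ ℤ.m-n≡m⊖n n m ⟨
  + n ℤ.- + m                    ∎
  where open ℤ.≤-Reasoning

-- From poset elements to indices in the ranks.

module _ {c ℓ₁ ℓ₂} {r : ℕ} .{{_ : NonZero r}} (𝒫 : DifferentialPoset r c ℓ₁ ℓ₂) where
  open DifferentialPoset 𝒫 hiding (_≤_; _≟_; refl; trans; reflexive; antisym)
  open LinearAlgebra ℚ-orderedDomain
  open FiniteSubset

  -- Relates rank `n - 1` to rank `n`. For `n = 0` it has no rows, so rank 0 needs no separate
  -- treatment in the commutation relation.
  covers : ∀ n → Adjacency (p⁻ n) (p n)
  covers n i j = does (lookup (P⁻ n) i ⋖? lookup (P n) j)

  -- `commutation` unfolds to this identity between sums, up to moving the subtracted term to the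
  -- other side.
  covers-commutes : ∀ n → Commutes (+ r ℚ./ 1) (covers n) (covers (suc n))
  covers-commutes n v i = x-y≡z⇒x≡z+y (commutation n v i)

  lookup-P-injective : ∀ n i j → lookup (P n) i ≈ lookup (P n) j → i ≡ j
  lookup-P-injective n = Unique⇒lookup-injective S (unique (finiteRank n))

  lookup-P⁻-injective : ∀ n i j → lookup (P⁻ n) i ≈ lookup (P⁻ n) j → i ≡ j
  lookup-P⁻-injective (suc n) = lookup-P-injective n

  index : ∀ {n x} → rank x ≡ n → Fin (p n)
  index {n} rx = Any.index (complete (finiteRank n) rx)

  lookup-index-≈ : ∀ {n x} (rx : rank x ≡ n) → x ≈ lookup (P n) (index rx)
  lookup-index-≈ {n} rx = lookup-index (complete (finiteRank n) rx)

  singleton-lower : ∀ {x y z} → IsSingleton x → y ⋖ x → z ⋖ x → y ≈ z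
  singleton-lower (inj₁ x≈0̂) y⋖x _ =
    let (y≤0̂ , y≉0̂) , _ = ⋖-respʳ x≈0̂ y⋖x in contradiction (0̂-minimal y≤0̂) y≉0̂
  singleton-lower (inj₂ (_ , _ , unq)) y⋖x z⋖x = Eq.trans (Eq.sym (unq y⋖x)) (unq z⋖x)

  singleton⇒CoversAtMostOne : ∀ {n x} (rx : rank x ≡ n) → IsSingleton x →
                              CoversAtMostOne (covers n) (index rx)
  singleton⇒CoversAtMostOne {n} {x} rx sing i j i⋖ j⋖ =
    lookup-P⁻-injective n i j (singleton-lower sing (below i i⋖) (below j j⋖))
    where
    below : ∀ i → covers n i (index rx) ≡ true → lookup (P⁻ n) i ⋖ x
    below i eq = ⋖-respʳ (Eq.sym (lookup-index-≈ rx))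
      (does≡true⇒ (lookup (P⁻ n) i ⋖? lookup (P n) (index rx)) eq)

  singleton⇒CoversOnly : ∀ {n x y} (rx : rank x ≡ suc n) (ry : rank y ≡ n) → IsSingleton x → y ⋖ x →
                         CoversOnly (covers (suc n)) (index rx) (index ry)
  singleton⇒CoversOnly {n} {x} {y} rx ry sing y⋖x z = does-⇔ (mk⇔ to from)
    (lookup (P n) z ⋖? lookup (P (suc n)) (index rx)) (index ry ≟ z)
    where
    to : lookup (P n) z ⋖ lookup (P (suc n)) (index rx) → index ry ≡ z
    to z⋖ = lookup-P-injective n _ z (Eq.trans (Eq.sym (lookup-index-≈ ry))
      (singleton-lower sing y⋖x (⋖-respʳ (Eq.sym (lookup-index-≈ rx)) z⋖)))
    from : index ry ≡ z → lookup (P n) z ⋖ lookup (P (suc n)) (index rx)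
    from refl = ⋖-respˡ (lookup-index-≈ ry) (⋖-respʳ (lookup-index-≈ rx) y⋖x)

  -- Families of threads and the final inequality.

  record ThreadFamily (k m : ℕ) : Set where
    field
      top       : Fin k → Fin (p (suc m))
      bottom    : Fin k → Fin (p m)
      only      : ∀ i → CoversOnly (covers (suc m)) (top i) (bottom i)
      single    : ∀ i → CoversAtMostOne (covers m) (bottom i)
      -- Distinctness is imposed on the tops alone, because several threads may cover the same
      -- singleton.
      injective : Injective _≡_ _≡_ top
  open ThreadFamily

  -- The old tops become the new bottoms, so from here on the bottoms are distinct as well.
  extend-family : ∀ {k m} → ThreadFamily k m → ThreadFamily k (suc m)
  extend-family {k} {m} T = record
    { top       = proj₁ ∘ next
    ; bottom    = top T
    ; only      = proj₂ ∘ next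
    ; single    = λ i → CoversOnly⇒CoversAtMostOne (covers (suc m)) {x = bottom T i} (only T i)
    ; injective = CoversOnly-injective (covers (suc (suc m))) (proj₂ ∘ next) (injective T)
    }
    where
    next : ∀ i → ∃[ y ] CoversOnly (covers (suc (suc m))) y (top T i)
    next i = thread-extends {r = + r ℚ./ 1} (covers m) (covers (suc m)) (covers (suc (suc m)))
      (covers-commutes m) (covers-commutes (suc m)) (single T i) (only T i)

  thread-family : ∀ m → ThreadFamily (τ (suc m)) m
  thread-family m = record
    { top       = λ i → index (rank-thread i)
    ; bottom    = λ i → index (rank-lower i)
    ; only      = λ i → singleton⇒CoversOnly (rank-thread i) (rank-lower i) (proj₁ (isThread i)) (proj₁ (proj₂ (lower i)))
    ; single    = λ i → singleton⇒CoversAtMostOne (rank-lower i) (proj₂ (proj₂ (lower i)))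
    ; injective = λ {i} {j} eq → Unique⇒lookup-injective S (unique (threads (suc m))) i j
        (Eq.trans (lookup-index-≈ (rank-thread i)) (Eq.trans (Eq.reflexive (cong (lookup (P (suc m))) eq))
          (Eq.sym (lookup-index-≈ (rank-thread j)))))
    }
    where
    thread : Fin (τ (suc m)) → Carrier
    thread = lookup (elements (threads (suc m)))
    thread-sound : ∀ i → rank (thread i) ≡ suc m × IsThread (thread i)
    thread-sound i = sound (threads (suc m)) (Mem.∈-lookup S _ i)
    rank-thread : ∀ i → rank (thread i) ≡ suc m
    rank-thread i = proj₁ (thread-sound i)
    isThread : ∀ i → IsThread (thread i)
    isThread i = proj₂ (thread-sound i)
    lower : ∀ i → ∃[ y ] (y ⋖ thread i × IsSingleton y)
    lower i = proj₂ (isThread i)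
    rank-lower : ∀ i → rank (proj₁ (lower i)) ≡ m
    rank-lower i = ℕ.suc-injective (trans (sym (rank-⋖ (proj₁ (proj₂ (lower i))))) (rank-thread i))

  -- The tops of `T`, `T₁` and `T₂` serve as `t″`, `t′` and `t`. Two extensions are made because
  -- `t″` must be injective, which the tops of `T` are.
  family⇒gap : ∀ {k m} → ThreadFamily k m → p (2 ℕ.+ m) ℕ.+ k ≤ p (3 ℕ.+ m)
  family⇒gap {m = m} T = threads⇒gap (1≤r/1 r) (covers (2 ℕ.+ m)) (covers (3 ℕ.+ m)) (covers-commutes (2 ℕ.+ m))
    (only T₂) (only T₁) (injective T)
    where
    T₁ = extend-family T
    T₂ = extend-family T₁

  lift-family : ∀ {k m} d → ThreadFamily k m → ThreadFamily k (d ℕ.+ m)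
  lift-family zero    T = T
  lift-family (suc d) T = extend-family (lift-family d T)

  τ₀≡0 : τ 0 ≡ 0
  τ₀≡0 with elements (threads 0) | sound (threads 0)
  ... | []    | _   = refl
  ... | x ∷ _ | snd =
    let rx , _ , _ , y⋖x , _ = snd (here Eq.refl)
    in contradiction (trans (sym rx) (rank-⋖ y⋖x)) λ ()

  -- The gap argument with an empty family of threads, where it amounts to the injectivity of `U`.
  ranks-increase : ∀ N → p⁻ N ℕ.+ 0 ≤ p N
  ranks-increase zero    = ℕ.z≤n
  ranks-increase (suc n) = threads⇒gap (1≤r/1 r) (covers n) (covers (suc n)) (covers-commutes n)
    {t = λ ()} {t′ = λ ()} {t″ = λ ()} (λ ()) (λ ()) λ { {()} }

  τ≤Δp : ∀ n N → 4 * n ≤ N → + τ n ℤ.≤ Δp N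
  τ≤Δp zero    N _ rewrite τ₀≡0 = m+k≤n⇒k≤n-m (ranks-increase N)
  τ≤Δp (suc m) N 4n≤N = subst (λ N → + τ (suc m) ℤ.≤ Δp N) eq
    (m+k≤n⇒k≤n-m (family⇒gap (lift-family d (thread-family m))))
    where
    -- With `n = m + 1`, this is `N ≥ n + 2`; it follows from `4n = 3n + n ≥ 3 + n`.
    3+m≤N : 3 ℕ.+ m ≤ N
    3+m≤N = ℕ.≤-trans (ℕ.≤-trans
      (ℕ.+-monoʳ-≤ 3 (ℕ.n≤1+n m))
      (subst (3 ℕ.+ suc m ≤_) (ℕ.+-comm (3 * suc m) (suc m)) (ℕ.+-monoˡ-≤ (suc m) (ℕ.m≤m*n 3 (suc m))))) 4n≤N
    -- Here `d = N - n - 2`: lifting by `d` puts the tops in rank `N - 2`, and the two extensions in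
    -- `family⇒gap` reach rank `N`.
    d = proj₁ (ℕ.m≤n⇒∃[o]m+o≡n 3+m≤N)
    eq : 3 ℕ.+ (d ℕ.+ m) ≡ N
    eq = trans (cong (3 ℕ.+_) (ℕ.+-comm d m)) (proj₂ (ℕ.m≤n⇒∃[o]m+o≡n 3+m≤N))

theorem3p3 : ∀ {c ℓ₁ ℓ₂} (r : ℕ) .{{_ : NonZero r}} (𝒫 : DifferentialPoset r c ℓ₁ ℓ₂) (n N : ℕ) →
    4 * n ≤ N → + DifferentialPoset.τ 𝒫 n ℤ.≤ DifferentialPoset.Δp 𝒫 N
theorem3p3 r 𝒫 = τ≤Δp 𝒫
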